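{- Let $W$ be a normal PO-dilator and $X$ a partial order. Then the partial order $\mathcal T W(X)$ together with the functions $\iota_X$ and $\kappa_X$ forms a Kruskal fixed point of $W$ over $X$.
   Context: A quasi embedding between partial orders $X,Y$ is a function $f$ with $f(x)\leq_Y f(y)\Rightarrow x\leq_X y$; an embedding also satisfies the converse. $\mathrm{PO}$ is the category of partial orders and quasi embeddings. $[X]^{<\omega}$ denotes the finite subsets of $X$, with $[f]^{<\omega}(a)=\{f(x)\mid x\in a\}$; subsets of partial orders are regarded as suborders and $\iota_a$ denotes an inclusion map. A PO-dilator is a functor $W:\mathrm{PO}\to\mathrm{PO}$ mapping embeddings to embeddings, with a natural transformation $\operatorname{supp}^W:W\Rightarrow[\cdot]^{<\omega}$ such that for every embedding $f:X\to Y$, $\operatorname{rng}(W(f))=\{\sigma\in W(Y)\mid\operatorname{supp}^W_Y(\sigma)\subseteq\operatorname{rng}(f)\}$. For finite $a,b\subseteq X$, $a\leq^{\mathrm{fin}}_X b$ iff every $x\in a$ has some $y\in b$ with $x\leq_X y$ (for a single element $z$ write $z\leq^{\mathrm{fin}}_X b$ for $\{z\}\leq^{\mathrm{fin}}_X b$). $W$ is normal if $\sigma\leq_{W(X)}\tau$ implies $\operatorname{supp}^W_X(\sigma)\leq^{\mathrm{fin}}_X\operatorname{supp}^W_X(\tau)$. For $\sigma\in W(X)$ one writes $\sigma=_{\mathrm{NF}}W(\iota_a)(\sigma_0)$ if $a\in[X]^{<\omega}$, $\sigma_0\in W(a)$, $\sigma=W(\iota_a)(\sigma_0)$ and $\operatorname{supp}^W_a(\sigma_0)=a$;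 every $\sigma$ has exactly one such representation. For a normal PO-dilator $W$ and partial order $X$, the set $\mathcal T W(X)$ and relation $\leq_{\mathcal T W(X)}$ are defined by simultaneous recursion. Terms: (i) $\overline x$ for each $x\in X$; (ii) for each finite $a\subseteq\mathcal T W(X)$ on which the restriction of $\leq_{\mathcal T W(X)}$ is a partial order, and each $\sigma\in W(a)$ with $\operatorname{supp}^W_a(\sigma)=a$, a term $\circ(a,\sigma)$. Relation: $s\leq_{\mathcal T W(X)}t$ iff (i') $s=\overline x$, $t=\overline y$, $x\leq_X y$; or (ii') $t=\circ(b,\tau)$ and $s\leq_{\mathcal T W(X)}t'$ for some $t'\in b$; or (iii') $s=\circ(a,\sigma)$, $t=\circ(b,\tau)$, the restriction of $\leq_{\mathcal T W(X)}$ to $a\cup b$ is a partial order, and $W(\iota_a)(\sigma)\leq_{W(a\cup b)}W(\iota_b)(\tau)$ for the inclusions into $a\cup b$. (The recursion is along the length $l(\overline x)=0$, $l(\circ(a,\sigma))=1+\sum_{r\in a}2\,l(r)$.) The relation $\leq_{\mathcal T W(X)}$ is a partial order on $\mathcal T W(X)$. Define $\iota_X:X\to\mathcal T W(X)$ by $\iota_X(x)=\overline x$ and $\kappa_X:W(\mathcal T W(X))\to\mathcal T W(X)$ by $\kappa_X(\sigma)=\circ(a,\sigma_0)$ where $\sigma=_{\mathrm{NF}}W(\iota_a)(\sigma_0)$. A Kruskal fixed point of a normal PO-dilator $W$ over a partial order $X$ is a partial order $Z$ with functions $\iota:X\to Z$ and $\kappa:W(Z)\to Z$ such that $\operatorname{rng}(\iota)\cap\operatorname{rng}(\kappa)=\emptyset$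 and: $\iota(x)\leq_Z\iota(y)$ implies $x\leq_X y$; $\iota(x)\leq_Z\kappa(\tau)$ iff $\iota(x)\leq^{\mathrm{fin}}_Z\operatorname{supp}^W_Z(\tau)$; $\kappa(\sigma)\not\leq_Z\iota(y)$ for all $\sigma,y$; and $\kappa(\sigma)\leq_Z\kappa(\tau)$ iff ($\sigma\leq_{W(Z)}\tau$ or $\kappa(\sigma)\leq^{\mathrm{fin}}_Z\operatorname{supp}^W_Z(\tau)$), for all $x,y\in X$, $\sigma,\tau\in W(Z)$. -}

module Defs where

open import Level using (Level; Lift; lift; suc)
open import Data.Nat.Base using (ℕ)
open import Data.Fin.Base using (Fin)
open import Data.Product.Base using (Σ-syntax; ∃-syntax; _×_; _,_; proj₁; proj₂)
open import Data.Sum.Base using (_⊎_; inj₁; inj₂)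
open import Data.Empty.Polymorphic using (⊥)
open import Function.Base using (id; _∘_)
open import Function.Bundles using (_⇔_; Equivalence)
open import Function.Definitions using (Congruent)
open import Relation.Binary.Bundles using (Poset)
open import Relation.Binary.Structures using (IsPartialOrder)
import Relation.Binary.Construct.On as On
open import Relation.Nullary.Negation.Core using (¬_)

private
  variable
    ℓ : Level

-- Partial orders are setoid-based: `_≈_` plays the role of equality of
-- elements, and antisymmetry is stated with respect to it.
PO : (ℓ : Level) → Set (suc ℓ)
PO ℓ = Poset ℓ ℓ ℓ

∣_∣ : PO ℓ → Set ℓ
∣_∣ = Poset.Carrier

infix 4 _⟶_

-- The field `cong` says that `fun` is a function between the underlying sets.
record _⟶_ (X Y : PO ℓ) : Set ℓ where
  private
    module X = Poset X
    module Y = Poset Y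
  field
    fun     : ∣ X ∣ → ∣ Y ∣
    cong    : ∀ {x y} → x X.≈ y → fun x Y.≈ fun y
    reflect : ∀ {x y} → fun x Y.≤ fun y → x X.≤ y

open _⟶_ public

idQ : (X : PO ℓ) → X ⟶ X
idQ X = record { fun = id ; cong = id ; reflect = id }

infixr 9 _∘Q_

_∘Q_ : {X Y Z : PO ℓ} → Y ⟶ Z → X ⟶ Y → X ⟶ Z
g ∘Q f = record
  { fun     = fun g ∘ fun f
  ; cong    = cong g ∘ cong f
  ; reflect = reflect f ∘ reflect g
  }

IsEmbedding : {X Y : PO ℓ} → X ⟶ Y → Set ℓ
IsEmbedding {X = X} {Y} f =
  ∀ {x y} → Poset._≤_ X x y → Poset._≤_ Y (fun f x) (fun f y)

Index : (ℓ : Level) → ℕ → Set ℓ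
Index ℓ n = Lift ℓ (Fin n)

-- A finite subset is given by an enumeration, possibly with repetitions;
-- two enumerations denote the same subset when they satisfy `≐` below.
record Finite (A : Set ℓ) : Set ℓ where
  constructor enum
  field
    {size} : ℕ
    elem   : Index ℓ size → A

open Finite public

image : {A B : Set ℓ} → (A → B) → Finite A → Finite B
image f a = enum (f ∘ elem a)

singleton : {A : Set ℓ} → A → Finite A
singleton x = enum {size = 1} (λ _ → x)

module FiniteSubsets (X : PO ℓ) where
  open Poset X

  infix 4 _∈_ _⊆_ _≐_ _≤fin_

  _∈_ : ∣ X ∣ → Finite ∣ X ∣ → Set ℓ
  x ∈ a = ∃[ i ] x ≈ elem a i

  _⊆_ : Finite ∣ X ∣ → Finite ∣ X ∣ → Set ℓ
  a ⊆ b = ∀ i → elem a i ∈ b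

  _≐_ : Finite ∣ X ∣ → Finite ∣ X ∣ → Set ℓ
  a ≐ b = a ⊆ b × b ⊆ a

  _≤fin_ : Finite ∣ X ∣ → Finite ∣ X ∣ → Set ℓ
  a ≤fin b = ∀ i → ∃[ j ] elem a i ≤ elem b j

-- The suborder on a finite subset. Its elements are the indices of the
-- enumeration, with equality and order pulled back from X.
sub : (X : PO ℓ) → Finite ∣ X ∣ → PO ℓ
sub X a = On.poset X (elem a)

incl : (X : PO ℓ) (a : Finite ∣ X ∣) → sub X a ⟶ X
incl X a = record { fun = elem a ; cong = id ; reflect = id }

-- The set a, as a subset of the suborder a.
full : ∀ n → Finite (Index ℓ n)
full n = enum {size = n} id

record PODilator (ℓ : Level) : Set (suc ℓ) where
  field
    obj : PO ℓ → PO ℓ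
    hom : {X Y : PO ℓ} → X ⟶ Y → obj X ⟶ obj Y

    hom-resp : {X Y : PO ℓ} (f g : X ⟶ Y) →
               (∀ x → Poset._≈_ Y (fun f x) (fun g x)) →
               ∀ σ → Poset._≈_ (obj Y) (fun (hom f) σ) (fun (hom g) σ)
    hom-id   : (X : PO ℓ) →
               ∀ σ → Poset._≈_ (obj X) (fun (hom (idQ X)) σ) σ
    hom-∘    : {X Y Z : PO ℓ} (g : Y ⟶ Z) (f : X ⟶ Y) →
               ∀ σ → Poset._≈_ (obj Z) (fun (hom (g ∘Q f)) σ)
                                       (fun (hom g) (fun (hom f) σ))

    hom-embedding : {X Y : PO ℓ} (f : X ⟶ Y) →
                    IsEmbedding f → IsEmbedding (hom f)

    supp         : (X : PO ℓ) → ∣ obj X ∣ → Finite ∣ X ∣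
    supp-cong    : (X : PO ℓ) → ∀ {σ τ} → Poset._≈_ (obj X) σ τ →
                   FiniteSubsets._≐_ X (supp X σ) (supp X τ)
    supp-natural : {X Y : PO ℓ} (f : X ⟶ Y) → ∀ σ →
                   FiniteSubsets._≐_ Y (supp Y (fun (hom f) σ))
                                       (image (fun f) (supp X σ))

    -- σ ∈ rng (W f) iff supp σ ⊆ rng f
    range : {X Y : PO ℓ} (f : X ⟶ Y) → IsEmbedding f → ∀ σ →
            (∃[ σ₀ ] Poset._≈_ (obj Y) (fun (hom f) σ₀) σ)
              ⇔
            (∀ i → ∃[ x ] Poset._≈_ Y (fun f x) (elem (supp Y σ) i))

IsNormal : PODilator ℓ → Set (suc ℓ)
IsNormal {ℓ} W =
  (X : PO ℓ) → ∀ {σ τ} → Poset._≤_ (obj X) σ τ →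
  FiniteSubsets._≤fin_ X (supp X σ) (supp X τ)
  where open PODilator W

module NormalForm (W : PODilator ℓ) (X : PO ℓ) where
  open PODilator W

  record NF (σ : ∣ obj X ∣) : Set ℓ where
    field
      a   : Finite ∣ X ∣
      σ₀  : ∣ obj (sub X a) ∣
      eq  : Poset._≈_ (obj X) σ (fun (hom (incl X a)) σ₀)
      all : FiniteSubsets._≐_ (sub X a) (supp (sub X a) σ₀) (full (size a))

  nf : ∀ σ → NF σ
  nf σ = record
    { a   = a
    ; σ₀  = σ₀
    ; eq  = Poset.Eq.sym (obj X) σ₀-eq
    ; all = (λ i → elem (supp (sub X a) σ₀) i , Poset.Eq.refl X) , a⊆supp
    }
    where
    a = supp X σ

    preimage : ∃[ σ₀ ] Poset._≈_ (obj X) (fun (hom (incl X a)) σ₀) σ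
    preimage = Equivalence.from (range (incl X a) id σ)
                                (λ i → i , Poset.Eq.refl X)

    σ₀    = proj₁ preimage
    σ₀-eq = proj₂ preimage

    a⊆supp : FiniteSubsets._⊆_ (sub X a) (full (size a)) (supp (sub X a) σ₀)
    a⊆supp i =
      let j , p = proj₂ (supp-cong X σ₀-eq) i
          k , q = proj₁ (supp-natural (incl X a) σ₀) j
      in  k , Poset.Eq.trans X p q

module TermOrder (W : PODilator ℓ) (X : PO ℓ) where
  open PODilator W

  infix 4 _≈ᵀ_ _≤ᵀ_

  -- Terms, their equality and their order are defined simultaneously, by
  -- induction-recursion. The relations recurse structurally on both terms,
  -- which takes the place of a recursion along the length of terms.
  data 𝒯 : Set ℓ
  _≈ᵀ_ : 𝒯 → 𝒯 → Set ℓ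
  _≤ᵀ_ : 𝒯 → 𝒯 → Set ℓ

  IsPO : ∀ {n} → (Index ℓ n → 𝒯) → Set ℓ
  IsPO a = IsPartialOrder (λ i j → a i ≈ᵀ a j) (λ i j → a i ≤ᵀ a j)

  subᵀ : ∀ {n} (a : Index ℓ n → 𝒯) → IsPO a → PO ℓ
  subᵀ a po = record { isPartialOrder = po }

  data 𝒯 where
    var  : ∣ X ∣ → 𝒯
    node : ∀ {n} (a : Index ℓ n → 𝒯) (po : IsPO a) (σ : ∣ obj (subᵀ a po) ∣) →
           FiniteSubsets._≐_ (subᵀ a po) (supp (subᵀ a po) σ) (full n) →
           𝒯

  -- The restrictions of ≈ᵀ and ≤ᵀ to a ∪ b, which is enumerated by the
  -- disjoint union of the index sets of a and b.
  module _ {m n} (a : Index ℓ m → 𝒯) (b : Index ℓ n → 𝒯) where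

    Eq∪ : Index ℓ m ⊎ Index ℓ n → Index ℓ m ⊎ Index ℓ n → Set ℓ
    Eq∪ (inj₁ i) (inj₁ j) = a i ≈ᵀ a j
    Eq∪ (inj₁ i) (inj₂ j) = a i ≈ᵀ b j
    Eq∪ (inj₂ i) (inj₁ j) = b i ≈ᵀ a j
    Eq∪ (inj₂ i) (inj₂ j) = b i ≈ᵀ b j

    Le∪ : Index ℓ m ⊎ Index ℓ n → Index ℓ m ⊎ Index ℓ n → Set ℓ
    Le∪ (inj₁ i) (inj₁ j) = a i ≤ᵀ a j
    Le∪ (inj₁ i) (inj₂ j) = a i ≤ᵀ b j
    Le∪ (inj₂ i) (inj₁ j) = b i ≤ᵀ a j
    Le∪ (inj₂ i) (inj₂ j) = b i ≤ᵀ b j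

    IsPO∪ : Set ℓ
    IsPO∪ = IsPartialOrder Eq∪ Le∪

    sub∪ : IsPO∪ → PO ℓ
    sub∪ po = record { isPartialOrder = po }

    inclˡ : (pa : IsPO a) (po : IsPO∪) → subᵀ a pa ⟶ sub∪ po
    inclˡ pa po = record { fun = inj₁ ; cong = id ; reflect = id }

    inclʳ : (pb : IsPO b) (po : IsPO∪) → subᵀ b pb ⟶ sub∪ po
    inclʳ pb po = record { fun = inj₂ ; cong = id ; reflect = id }

  -- ∘(a,σ) and ∘(b,τ) are the same term when a = b as sets and σ, τ agree
  -- after transport to the order on a ∪ b (which equals a and b).
  var x        ≈ᵀ var y         = Poset._≈_ X x y
  var x        ≈ᵀ node b pb τ _ = ⊥
  node a _ σ _ ≈ᵀ var y         = ⊥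
  node a pa σ _ ≈ᵀ node b pb τ _ =
    (∀ i → ∃[ j ] a i ≈ᵀ b j) × (∀ j → ∃[ i ] b j ≈ᵀ a i) ×
    Σ[ po ∈ IsPO∪ a b ]
      Poset._≈_ (obj (sub∪ a b po)) (fun (hom (inclˡ a b pa po)) σ)
                                    (fun (hom (inclʳ a b pb po)) τ)

  var x ≤ᵀ var y         = Poset._≤_ X x y
  var x ≤ᵀ node b pb τ _ = ∃[ j ] var x ≤ᵀ b j
  node a _ σ _ ≤ᵀ var y  = ⊥
  s@(node a pa σ _) ≤ᵀ node b pb τ _ =
    (∃[ j ] s ≤ᵀ b j)
      ⊎
    Σ[ po ∈ IsPO∪ a b ]
      Poset._≤_ (obj (sub∪ a b po)) (fun (hom (inclˡ a b pa po)) σ)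
                                    (fun (hom (inclʳ a b pb po)) τ)

  -- That ≤ᵀ is a partial order (for normal W) is a theorem, hence the
  -- argument; κ needs it because W acts on partial orders only.
  order : IsPartialOrder _≈ᵀ_ _≤ᵀ_ → PO ℓ
  order po = record { isPartialOrder = po }

  ι : ∣ X ∣ → 𝒯
  ι = var

  κ : (po : IsPartialOrder _≈ᵀ_ _≤ᵀ_) → ∣ obj (order po) ∣ → 𝒯
  κ po σ = node (elem a) (On.isPartialOrder (elem a) po) σ₀ all
    where open NormalForm.NF (NormalForm.nf W (order po) σ)

-- The first two fields say that ι and κ are functions with respect to the
-- setoid equalities.
record IsKruskalFixedPoint
  (W : PODilator ℓ) (X Z : PO ℓ)
  (ι : ∣ X ∣ → ∣ Z ∣) (κ : ∣ PODilator.obj W Z ∣ → ∣ Z ∣) : Set ℓ where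
  open PODilator W
  open FiniteSubsets Z
  private
    module X = Poset X
    module Z = Poset Z
    module WZ = Poset (obj Z)
  field
    ι-cong   : Congruent X._≈_ Z._≈_ ι
    κ-cong   : Congruent WZ._≈_ Z._≈_ κ
    disjoint : ∀ x σ → ¬ (ι x Z.≈ κ σ)
    ι≤ι      : ∀ x y → ι x Z.≤ ι y → x X.≤ y
    ι≤κ      : ∀ x τ → ι x Z.≤ κ τ ⇔ singleton (ι x) ≤fin supp Z τ
    κ≰ι      : ∀ σ y → ¬ (κ σ Z.≤ ι y)
    κ≤κ      : ∀ σ τ → κ σ Z.≤ κ τ ⇔
                       (σ WZ.≤ τ ⊎ singleton (κ σ) ≤fin supp Z τ)

{-# OPTIONS --safe #-}
-- The height of terms is monotone: by normality, an inequality between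
-- W-parts bounds each child on the left by a child on the right. The partial
-- order laws are proved by induction on a bound for the heights. If the terms
-- of height < n form a partial order Z, then a node of height < n + 1 has a
-- code in W(Z), the image of its W-part under the inclusion of its children.
-- Since W preserves and reflects the order along embeddings, clause (iii')
-- and the equality of nodes amount to ≤ and ≈ of codes in W(Z), without
-- reference to a ∪ b. Once 𝒯 is a partial order, the same applies to Z = 𝒯,
-- where the code of κ(σ) is σ itself.
module Submission where

open import Defs
open import Level using (Level; lift; lower)
open import Data.Empty using (⊥-elim)
open import Data.Fin.Base as Fin using (Fin)
open import Data.Nat.Base using (ℕ; zero; suc; _≤_; _<_; _⊔_; z≤n; s≤s; s≤s⁻¹)
open import Data.Nat.Properties
  using (≤-refl; ≤-trans; <⇒≤; <-trans; <-irrefl; m≤m⊔n; m≤n⊔m; ⊔-lub)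
open import Data.Product.Base using (Σ-syntax; _,_; proj₁; proj₂)
open import Data.Sum.Base using (_⊎_; inj₁; inj₂; [_,_]′)
open import Data.Vec.Functional using (foldr)
open import Function.Base using (id; _∘_; _on_)
open import Function.Bundles using (mk⇔)
open import Relation.Binary.Bundles using (Poset)
import Relation.Binary.Construct.On as On
open import Relation.Binary.PropositionalEquality using (_≡_; refl; sym; subst)
open import Relation.Binary.Structures using (IsPartialOrder)
open import Relation.Nullary.Negation.Core using (¬_)

private
  variable
    ℓ : Level

-- Maxima of finite families of natural numbers.

max : ∀ {n} → (Fin n → ℕ) → ℕ
max = foldr _⊔_ 0

≤max : ∀ {n} (f : Fin n → ℕ) i → f i ≤ max f
≤max f Fin.zero    = m≤m⊔n _ _
≤max f (Fin.suc i) = ≤-trans (≤max (f ∘ Fin.suc) i) (m≤n⊔m _ _)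

max-lub : ∀ {n} (f : Fin n → ℕ) {k} → (∀ i → f i ≤ k) → max f ≤ k
max-lub {zero}  f le = z≤n
max-lub {suc n} f le = ⊔-lub (le Fin.zero) (max-lub (f ∘ Fin.suc) (le ∘ Fin.suc))

-- Equality and supports under the action of a dilator.

module Dilator (W : PODilator ℓ) where
  open PODilator W
  open FiniteSubsets

  -- Quasi embeddings reflect the order, and antisymmetry turns this into reflection of equality.
  hom-≈-reflect : {Y Z : PO ℓ} (f : Y ⟶ Z) → ∀ {σ τ} →
                  Poset._≈_ (obj Z) (fun (hom f) σ) (fun (hom f) τ) →
                  Poset._≈_ (obj Y) σ τ
  hom-≈-reflect {Y} {Z} f e =
    Poset.antisym (obj Y)
      (reflect (hom f) (Poset.reflexive (obj Z) e))
      (reflect (hom f) (Poset.reflexive (obj Z) (Poset.Eq.sym (obj Z) e)))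

  supp-hom : {Y Z : PO ℓ} (f : Y ⟶ Z) {σ : ∣ obj Y ∣} {u : Finite ∣ Y ∣} →
             _≐_ Y (supp Y σ) u →
             _≐_ Z (supp Z (fun (hom f) σ)) (image (fun f) u)
  supp-hom {Y} {Z} f {σ} (s⊆u , u⊆s) =
      (λ i → let j , p = proj₁ (supp-natural f σ) i
                 k , q = s⊆u j
             in  k , Poset.Eq.trans Z p (cong f q))
    , (λ i → let j , p = u⊆s i
                 k , q = proj₂ (supp-natural f σ) j
             in  k , Poset.Eq.trans Z (cong f p) q)

  module _ {Y₁ Y₂ Z : PO ℓ} (f : Y₁ ⟶ Z) (g : Y₂ ⟶ Z)
           {σ : ∣ obj Y₁ ∣} {τ : ∣ obj Y₂ ∣} {u : Finite ∣ Y₁ ∣} {v : Finite ∣ Y₂ ∣}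
           (σ-supp : _≐_ Y₁ (supp Y₁ σ) u) (τ-supp : _≐_ Y₂ (supp Y₂ τ) v) where

    -- In every use `u` and `v` are full index sets, so their images enumerate the children of two
    -- nodes: a comparison of `W`-parts yields one of children.
    hom-≤⇒≤fin : IsNormal W →
                 Poset._≤_ (obj Z) (fun (hom f) σ) (fun (hom g) τ) →
                 _≤fin_ Z (image (fun f) u) (image (fun g) v)
    hom-≤⇒≤fin normal le i =
      let j , p = proj₂ (supp-hom f σ-supp) i
          k , q = normal Z le j
          l , r = proj₁ (supp-hom g τ-supp) k
      in  l , Poset.trans Z (Poset.reflexive Z p) (Poset.trans Z q (Poset.reflexive Z r))

    hom-≈⇒⊆ : Poset._≈_ (obj Z) (fun (hom f) σ) (fun (hom g) τ) →
              _⊆_ Z (image (fun f) u) (image (fun g) v)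
    hom-≈⇒⊆ e i =
      let j , p = proj₂ (supp-hom f σ-supp) i
          k , q = proj₁ (supp-cong Z e) j
          l , r = proj₁ (supp-hom g τ-supp) k
      in  l , Poset.Eq.trans Z p (Poset.Eq.trans Z q r)

-- Heights of terms.

module Terms (W : PODilator ℓ) (X : PO ℓ) where
  open PODilator W
  open Dilator W
  open TermOrder W X
  private module X = Poset X

  height : 𝒯 → ℕ
  height (var x)        = 0
  height (node a _ _ _) = suc (max (λ i → height (a (lift i))))

  Full : ∀ {n} (a : Index ℓ n → 𝒯) (pa : IsPO a) → ∣ obj (subᵀ a pa) ∣ → Set ℓ
  Full {n} a pa σ = FiniteSubsets._≐_ (subᵀ a pa) (supp (subᵀ a pa) σ) (full n)

  child-height : ∀ {n} (a : Index ℓ n → 𝒯) {pa σ} (σ-full : Full a pa σ) →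
                 ∀ i → height (a i) < height (node a pa σ σ-full)
  child-height a _ (lift i) = s≤s (≤max (λ i → height (a (lift i))) i)

  -- Codes of nodes.

  module Codes {C : Set ℓ} (g : C → 𝒯)
               (po : IsPartialOrder (_≈ᵀ_ on g) (_≤ᵀ_ on g)) where

    -- The map `g` lets one construction serve both the terms of bounded height (`g = proj₁`) and
    -- all terms (`g = id`).
    Z : PO ℓ
    Z = record { isPartialOrder = po }

    private
      module WZ = Poset (obj Z)

    inclᶻ : ∀ {n} (a : Index ℓ n → C) (pa : IsPO (g ∘ a)) → subᵀ (g ∘ a) pa ⟶ Z
    inclᶻ a pa = record { fun = a ; cong = id ; reflect = id }

    code : ∀ {n} (a : Index ℓ n → C) (pa : IsPO (g ∘ a)) →
           ∣ obj (subᵀ (g ∘ a) pa) ∣ → ∣ obj Z ∣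
    code a pa σ = fun (hom (inclᶻ a pa)) σ

    module _ {m n} (a : Index ℓ m → C) (b : Index ℓ n → C) where

      -- The relations on the union are pulled back from `Z` along `[ a , b ]′`, but this holds
      -- definitionally only once both summands are known.
      Eq∪≡ : ∀ x y → Eq∪ (g ∘ a) (g ∘ b) x y ≡ (g ([ a , b ]′ x) ≈ᵀ g ([ a , b ]′ y))
      Eq∪≡ (inj₁ _) (inj₁ _) = refl
      Eq∪≡ (inj₁ _) (inj₂ _) = refl
      Eq∪≡ (inj₂ _) (inj₁ _) = refl
      Eq∪≡ (inj₂ _) (inj₂ _) = refl

      Le∪≡ : ∀ x y → Le∪ (g ∘ a) (g ∘ b) x y ≡ (g ([ a , b ]′ x) ≤ᵀ g ([ a , b ]′ y))
      Le∪≡ (inj₁ _) (inj₁ _) = refl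
      Le∪≡ (inj₁ _) (inj₂ _) = refl
      Le∪≡ (inj₂ _) (inj₁ _) = refl
      Le∪≡ (inj₂ _) (inj₂ _) = refl

      Eq∪⇒≈ : ∀ {x y} → Eq∪ (g ∘ a) (g ∘ b) x y → g ([ a , b ]′ x) ≈ᵀ g ([ a , b ]′ y)
      Eq∪⇒≈ {x} {y} = subst id (Eq∪≡ x y)

      ≈⇒Eq∪ : ∀ {x y} → g ([ a , b ]′ x) ≈ᵀ g ([ a , b ]′ y) → Eq∪ (g ∘ a) (g ∘ b) x y
      ≈⇒Eq∪ {x} {y} = subst id (sym (Eq∪≡ x y))

      Le∪⇒≤ : ∀ {x y} → Le∪ (g ∘ a) (g ∘ b) x y → g ([ a , b ]′ x) ≤ᵀ g ([ a , b ]′ y)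
      Le∪⇒≤ {x} {y} = subst id (Le∪≡ x y)

      ≤⇒Le∪ : ∀ {x y} → g ([ a , b ]′ x) ≤ᵀ g ([ a , b ]′ y) → Le∪ (g ∘ a) (g ∘ b) x y
      ≤⇒Le∪ {x} {y} = subst id (sym (Le∪≡ x y))

      isPO∪ : IsPO∪ (g ∘ a) (g ∘ b)
      isPO∪ = record
        { isPreorder = record
          { isEquivalence = record
            { refl  = λ {x} → ≈⇒Eq∪ {x} {x} (Poset.Eq.refl Z)
            ; sym   = λ {x} {y} p → ≈⇒Eq∪ {y} {x} (Poset.Eq.sym Z (Eq∪⇒≈ {x} {y} p))
            ; trans = λ {x} {y} {z} p q →
                ≈⇒Eq∪ {x} {z} (Poset.Eq.trans Z (Eq∪⇒≈ {x} {y} p) (Eq∪⇒≈ {y} {z} q))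
            }
          ; reflexive = λ {x} {y} p → ≤⇒Le∪ {x} {y} (Poset.reflexive Z (Eq∪⇒≈ {x} {y} p))
          ; trans = λ {x} {y} {z} p q →
              ≤⇒Le∪ {x} {z} (Poset.trans Z (Le∪⇒≤ {x} {y} p) (Le∪⇒≤ {y} {z} q))
          }
        ; antisym = λ {x} {y} p q →
            ≈⇒Eq∪ {x} {y} (Poset.antisym Z (Le∪⇒≤ {x} {y} p) (Le∪⇒≤ {y} {x} q))
        }

      module _ (po∪ : IsPO∪ (g ∘ a) (g ∘ b)) where

        incl∪ : sub∪ (g ∘ a) (g ∘ b) po∪ ⟶ Z
        incl∪ = record
          { fun     = [ a , b ]′
          ; cong    = λ {x} {y} → Eq∪⇒≈ {x} {y}
          ; reflect = λ {x} {y} → ≤⇒Le∪ {x} {y}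
          }

        incl∪-embedding : IsEmbedding incl∪
        incl∪-embedding {x} {y} = Le∪⇒≤ {x} {y}

        -- By functoriality, as including `a` first into the union and then into `Z` is pointwise
        -- the direct inclusion. The order proof `po∪` is kept arbitrary because a given comparison
        -- of nodes brings its own.
        incl∪-inclˡ : ∀ pa σ →
          fun (hom incl∪) (fun (hom (inclˡ (g ∘ a) (g ∘ b) pa po∪)) σ) WZ.≈ code a pa σ
        incl∪-inclˡ pa σ = WZ.Eq.trans
          (WZ.Eq.sym (hom-∘ incl∪ (inclˡ (g ∘ a) (g ∘ b) pa po∪) σ))
          (hom-resp (incl∪ ∘Q inclˡ (g ∘ a) (g ∘ b) pa po∪) (inclᶻ a pa)
            (λ _ → Poset.Eq.refl Z) σ)

        incl∪-inclʳ : ∀ pb τ →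
          fun (hom incl∪) (fun (hom (inclʳ (g ∘ a) (g ∘ b) pb po∪)) τ) WZ.≈ code b pb τ
        incl∪-inclʳ pb τ = WZ.Eq.trans
          (WZ.Eq.sym (hom-∘ incl∪ (inclʳ (g ∘ a) (g ∘ b) pb po∪) τ))
          (hom-resp (incl∪ ∘Q inclʳ (g ∘ a) (g ∘ b) pb po∪) (inclᶻ b pb)
            (λ _ → Poset.Eq.refl Z) τ)

        ∪≤⇒code≤ : ∀ {pa σ pb τ} →
          Poset._≤_ (obj (sub∪ (g ∘ a) (g ∘ b) po∪))
            (fun (hom (inclˡ (g ∘ a) (g ∘ b) pa po∪)) σ)
            (fun (hom (inclʳ (g ∘ a) (g ∘ b) pb po∪)) τ) →
          code a pa σ WZ.≤ code b pb τ
        ∪≤⇒code≤ {pa} {σ} {pb} {τ} p =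
          WZ.trans (WZ.reflexive (WZ.Eq.sym (incl∪-inclˡ pa σ)))
          (WZ.trans (hom-embedding incl∪ (λ {x} {y} → incl∪-embedding {x} {y}) p)
                    (WZ.reflexive (incl∪-inclʳ pb τ)))

      module _ {pa : IsPO (g ∘ a)} {σ : ∣ obj (subᵀ (g ∘ a) pa) ∣} (σ-full : Full (g ∘ a) pa σ)
               {pb : IsPO (g ∘ b)} {τ : ∣ obj (subᵀ (g ∘ b) pb) ∣} (τ-full : Full (g ∘ b) pb τ)
               where

        -- Clause (iii') applies: the union is a partial order because `Z` is, and `incl∪` under `W`
        -- reflects the inequality back to it.
        code≤⇒ : code a pa σ WZ.≤ code b pb τ →
                 node (g ∘ a) pa σ σ-full ≤ᵀ node (g ∘ b) pb τ τ-full
        code≤⇒ p = inj₂ (isPO∪ , reflect (hom (incl∪ isPO∪))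
          (WZ.trans (WZ.reflexive (incl∪-inclˡ isPO∪ pa σ))
          (WZ.trans p (WZ.reflexive (WZ.Eq.sym (incl∪-inclʳ isPO∪ pb τ))))))

        node≈⇒ : node (g ∘ a) pa σ σ-full ≈ᵀ node (g ∘ b) pb τ τ-full →
                 code a pa σ WZ.≈ code b pb τ
        node≈⇒ (_ , _ , po∪ , p) =
          WZ.Eq.trans (WZ.Eq.sym (incl∪-inclˡ po∪ pa σ))
          (WZ.Eq.trans (cong (hom (incl∪ po∪)) p) (incl∪-inclʳ po∪ pb τ))

        -- Equal codes have equal supports, and these are the two sets of children; this gives both
        -- inclusions.
        code≈⇒ : code a pa σ WZ.≈ code b pb τ →
                 node (g ∘ a) pa σ σ-full ≈ᵀ node (g ∘ b) pb τ τ-full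
        code≈⇒ p =
            hom-≈⇒⊆ (inclᶻ a pa) (inclᶻ b pb) σ-full τ-full p
          , hom-≈⇒⊆ (inclᶻ b pb) (inclᶻ a pa) τ-full σ-full (WZ.Eq.sym p)
          , isPO∪
          , hom-≈-reflect (incl∪ isPO∪)
              (WZ.Eq.trans (incl∪-inclˡ isPO∪ pa σ)
              (WZ.Eq.trans p (WZ.Eq.sym (incl∪-inclʳ isPO∪ pb τ))))

  -- Monotonicity of the height.

  module Normal (normal : IsNormal W) where

    height-mono : ∀ s t → s ≤ᵀ t → height s ≤ height t
    height-mono (var x) t p = z≤n
    height-mono s@(node _ _ _ _) (node b pb τ τ-full) (inj₁ (j , p)) =
      ≤-trans (height-mono s (b j) p) (<⇒≤ (child-height b τ-full j))
    height-mono (node a pa σ σ-full) (node b pb τ τ-full) (inj₂ (po∪ , p)) =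
      s≤s (max-lub _ λ i →
        -- Between a left and a right summand, the order of the union computes to `≤ᵀ`, so `q`
        -- compares two children and the recursion applies.
        let j , q = hom-≤⇒≤fin (inclˡ a b pa po∪) (inclʳ a b pb po∪)
                      σ-full τ-full normal p (lift i)
        in  ≤-trans (height-mono (a (lift i)) (b j) q)
                    (≤max (λ j → height (b (lift j))) (lower j)))

    node≰child : ∀ {n} (a : Index ℓ n → 𝒯) {pa σ} (σ-full : Full a pa σ) →
                 ∀ i → ¬ (node a pa σ σ-full ≤ᵀ a i)
    node≰child a σ-full i p =
      <-irrefl refl (≤-trans (child-height a σ-full i) (height-mono _ (a i) p))

    -- The partial order laws below a height bound.

    Below : ℕ → Set ℓ
    Below n = Σ[ t ∈ 𝒯 ] height t < n

    IsPO< : ℕ → Set ℓ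
    IsPO< n = IsPartialOrder {A = Below n} (_≈ᵀ_ on proj₁) (_≤ᵀ_ on proj₁)

    module Step {n} (ih : IsPO< n) where
      open Codes {C = Below n} proj₁ ih
      private
        module WZ = Poset (obj Z)

      -- The height drops strictly from a node to its children, so a node under the bound `suc n`
      -- has a code over the order given by `ih`.
      children : ∀ {m} {a : Index ℓ m → 𝒯} {pa σ} (σ-full : Full a pa σ) →
                 height (node a pa σ σ-full) < suc n → Index ℓ m → Below n
      children {a = a} σ-full h i = a i , ≤-trans (child-height a σ-full i) (s≤s⁻¹ h)

      child< : ∀ {m} {a : Index ℓ m → 𝒯} {pa σ} (σ-full : Full a pa σ) →
               height (node a pa σ σ-full) < suc n → ∀ i → height (a i) < suc n
      child< {a = a} σ-full h i = <-trans (child-height a σ-full i) h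

      ≈-refl : ∀ s → height s < suc n → s ≈ᵀ s
      ≈-refl (var x) _ = X.Eq.refl
      ≈-refl (node a pa σ u) h =
        code≈⇒ (children u h) (children u h) u u WZ.Eq.refl

      ≈-sym : ∀ s t → height s < suc n → height t < suc n → s ≈ᵀ t → t ≈ᵀ s
      ≈-sym (var x) (var y) _ _ p = X.Eq.sym p
      ≈-sym (node a pa σ u) (node b pb τ v) h k p =
        code≈⇒ (children v k) (children u h) v u
          (WZ.Eq.sym (node≈⇒ (children u h) (children v k) u v p))

      ≈-trans : ∀ r s t → height r < suc n → height s < suc n → height t < suc n →
                r ≈ᵀ s → s ≈ᵀ t → r ≈ᵀ t
      ≈-trans (var x) (var y) (var z) _ _ _ p q = X.Eq.trans p q
      ≈-trans (node a pa ρ u) (node b pb σ v) (node c pc τ w) h k l p q =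
        code≈⇒ (children u h) (children w l) u w
          (WZ.Eq.trans (node≈⇒ (children u h) (children v k) u v p)
                       (node≈⇒ (children v k) (children w l) v w q))

      ≤-reflexive : ∀ s t → height s < suc n → height t < suc n → s ≈ᵀ t → s ≤ᵀ t
      ≤-reflexive (var x) (var y) _ _ p = X.reflexive p
      ≤-reflexive (node a pa σ u) (node b pb τ v) h k p =
        code≤⇒ (children u h) (children v k) u v
          (WZ.reflexive (node≈⇒ (children u h) (children v k) u v p))

      -- Structural recursion on `t`, with `r` fixed. As `r` itself may have height `n`, the
      -- recursive calls stay under the bound `suc n`; `ih` enters only when both inequalities
      -- compare `W`-parts.
      ≤ᵀ-trans : ∀ r s t → height r < suc n → height s < suc n → height t < suc n →
                 r ≤ᵀ s → s ≤ᵀ t → r ≤ᵀ t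
      ≤ᵀ-trans (var x) (var y) (var z) _ _ _ p q = X.trans p q
      ≤ᵀ-trans r@(var _) s@(var _) (node c pc τ w) h k l p (j , q) =
        j , ≤ᵀ-trans r s (c j) h k (child< w l j) p q
      ≤ᵀ-trans r@(var _) s@(node _ _ _ _) (node c pc τ w) h k l p (inj₁ (j , q)) =
        j , ≤ᵀ-trans r s (c j) h k (child< w l j) p q
      ≤ᵀ-trans r@(var _) (node b pb σ v) (node c pc τ w) h k l (i , p) (inj₂ (po∪ , q)) =
        -- Here `r` lies below the child `b i` of the middle term, and normality provides a child of
        -- `t` above `b i`.
        let j , b≤c = hom-≤⇒≤fin (inclˡ b c pb po∪) (inclʳ b c pc po∪) v w normal q i
        in  j , ≤ᵀ-trans r (b i) (c j) h (child< v k i) (child< w l j) p b≤c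
      ≤ᵀ-trans r@(node _ _ _ _) s@(node _ _ _ _) (node c pc τ w) h k l p (inj₁ (j , q)) =
        inj₁ (j , ≤ᵀ-trans r s (c j) h k (child< w l j) p q)
      ≤ᵀ-trans r@(node _ _ _ _) (node b pb σ v) (node c pc τ w) h k l (inj₁ (i , p)) (inj₂ (po∪ , q)) =
        let j , b≤c = hom-≤⇒≤fin (inclˡ b c pb po∪) (inclʳ b c pc po∪) v w normal q i
        in  inj₁ (j , ≤ᵀ-trans r (b i) (c j) h (child< v k i) (child< w l j) p b≤c)
      ≤ᵀ-trans (node a pa ρ u) (node b pb σ v) (node c pc τ w) h k l (inj₂ (po₁ , p)) (inj₂ (po₂ , q)) =
        code≤⇒ (children u h) (children w l) u w
          (WZ.trans (∪≤⇒code≤ (children u h) (children v k) po₁ p)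
                    (∪≤⇒code≤ (children v k) (children w l) po₂ q))

      -- If either inequality between nodes came from clause (ii'), transitivity would put a node
      -- below its own child, contradicting monotonicity of the height. What remains is antisymmetry
      -- of codes.
      ≤-antisym : ∀ s t → height s < suc n → height t < suc n → s ≤ᵀ t → t ≤ᵀ s → s ≈ᵀ t
      ≤-antisym (var x) (var y) _ _ p q = X.antisym p q
      ≤-antisym (var x) (node _ _ _ _) _ _ _ ()
      ≤-antisym s@(node _ _ _ _) t@(node b pb τ v) h k (inj₁ (j , p)) q =
        ⊥-elim (node≰child b v j (≤ᵀ-trans t s (b j) k h (child< v k j) q p))
      ≤-antisym s@(node a pa σ u) t@(node _ _ _ _) h k p@(inj₂ _) (inj₁ (i , q)) =
        ⊥-elim (node≰child a u i (≤ᵀ-trans s t (a i) h k (child< u h i) p q))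
      ≤-antisym (node a pa σ u) (node b pb τ v) h k (inj₂ (po₁ , p)) (inj₂ (po₂ , q)) =
        code≈⇒ (children u h) (children v k) u v
          (WZ.antisym (∪≤⇒code≤ (children u h) (children v k) po₁ p)
                      (∪≤⇒code≤ (children v k) (children u h) po₂ q))

      isPO<-suc : IsPO< (suc n)
      isPO<-suc = record
        { isPreorder = record
          { isEquivalence = record
            { refl  = λ { {s , h} → ≈-refl s h }
            ; sym   = λ { {s , h} {t , k} → ≈-sym s t h k }
            ; trans = λ { {r , h} {s , k} {t , l} → ≈-trans r s t h k l }
            }
          ; reflexive = λ { {s , h} {t , k} → ≤-reflexive s t h k }
          ; trans     = λ { {r , h} {s , k} {t , l} → ≤ᵀ-trans r s t h k l }
          }
        ; antisym = λ { {s , h} {t , k} → ≤-antisym s t h k }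
        }

    isPO< : ∀ n → IsPO< n
    isPO< zero = record
      { isPreorder = record
        { isEquivalence = record
          { refl  = λ { {_ , ()} }
          ; sym   = λ { {_ , ()} }
          ; trans = λ { {_ , ()} }
          }
        ; reflexive = λ { {_ , ()} }
        ; trans     = λ { {_ , ()} }
        }
      ; antisym = λ { {_ , ()} }
      }
    isPO< (suc n) = Step.isPO<-suc (isPO< n)

    -- The partial order on all terms.

    isPO : IsPartialOrder _≈ᵀ_ _≤ᵀ_
    isPO = record
      { isPreorder = record
        { isEquivalence = record
          { refl  = λ {s} → Eq.refl (isPO< (suc (height s))) {s , ≤-refl}
          ; sym   = λ {s} {t} → Eq.sym (isPO< (bound s t t)) {below₁ s t t} {below₂ s t t}
          ; trans = λ {r} {s} {t} →
              Eq.trans (isPO< (bound r s t)) {below₁ r s t} {below₂ r s t} {below₃ r s t}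
          }
        ; reflexive = λ {s} {t} →
            reflexive (isPO< (bound s t t)) {below₁ s t t} {below₂ s t t}
        ; trans = λ {r} {s} {t} →
            trans (isPO< (bound r s t)) {below₁ r s t} {below₂ r s t} {below₃ r s t}
        }
      ; antisym = λ {s} {t} → antisym (isPO< (bound s t t)) {below₁ s t t} {below₂ s t t}
      }
      where
      open IsPartialOrder using (module Eq; reflexive; trans; antisym)

      -- Each law involves at most three terms; `suc` makes the bound strict, and binary laws repeat
      -- their last term.
      bound : 𝒯 → 𝒯 → 𝒯 → ℕ
      bound r s t = suc (height r ⊔ (height s ⊔ height t))

      below₁ below₂ below₃ : ∀ r s t → Below (bound r s t)
      below₁ r s t = r , s≤s (m≤m⊔n _ _)
      below₂ r s t = s , s≤s (≤-trans (m≤m⊔n _ _) (m≤n⊔m (height r) _))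
      below₃ r s t = t , s≤s (≤-trans (m≤n⊔m (height s) _) (m≤n⊔m (height r) _))

  -- The Kruskal fixed point conditions.

  module FixedPoint (po : IsPartialOrder _≈ᵀ_ _≤ᵀ_) where
    open Codes id po
    private
      module WZ = Poset (obj Z)
      module N σ = NormalForm.NF (NormalForm.nf W Z σ)

    -- For `g = id`, `code` is the action of the inclusion map in the normal form, so this is the
    -- normal form equation reversed.
    code-κ : ∀ σ → code (elem (N.a σ)) (On.isPartialOrder (elem (N.a σ)) po) (N.σ₀ σ) WZ.≈ σ
    code-κ σ = WZ.Eq.sym (N.eq σ)

    isKruskalFixedPoint : IsKruskalFixedPoint W X (order po) ι (κ po)
    isKruskalFixedPoint = record
      { ι-cong   = id
      ; κ-cong   = λ {σ} {τ} p →
          code≈⇒ (elem (N.a σ)) (elem (N.a τ)) (N.all σ) (N.all τ)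
            (WZ.Eq.trans (code-κ σ) (WZ.Eq.trans p (WZ.Eq.sym (code-κ τ))))
      ; disjoint = λ _ _ ()
      ; ι≤ι      = λ _ _ → id
      -- The children of `κ po τ` are enumerated by the support of `τ` itself, so clause (ii') is
      -- the required condition up to the single index of the singleton.
      ; ι≤κ      = λ x τ → mk⇔ (λ p _ → p) (λ p → p (lift Fin.zero))
      ; κ≰ι      = λ _ _ ()
      ; κ≤κ      = λ σ τ → mk⇔
          [ (λ p → inj₂ λ _ → p)
          , (λ (po∪ , p) → inj₁
              (WZ.trans (WZ.reflexive (WZ.Eq.sym (code-κ σ)))
              (WZ.trans (∪≤⇒code≤ (elem (N.a σ)) (elem (N.a τ)) po∪ p)
                        (WZ.reflexive (code-κ τ)))))
          ]′
          [ (λ p → code≤⇒ (elem (N.a σ)) (elem (N.a τ)) (N.all σ) (N.all τ)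
              (WZ.trans (WZ.reflexive (code-κ σ))
              (WZ.trans p (WZ.reflexive (WZ.Eq.sym (code-κ τ))))))
          , (λ p → inj₁ (p (lift Fin.zero)))
          ]′
      }

theorem3p3 : ∀ {ℓ : Level} (W : PODilator ℓ) → IsNormal W → (X : PO ℓ) →
    let open TermOrder W X in
    Σ[ po ∈ IsPartialOrder _≈ᵀ_ _≤ᵀ_ ] IsKruskalFixedPoint W X (order po) ι (κ po)
theorem3p3 W normal X = isPO , FixedPoint.isKruskalFixedPoint isPO
  where
  open Terms W X
  open Normal normal
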